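{- For any finite quasi-discrete closure model $\mathcal{M}=((X,\mathcal{C}_R),\mathcal{V})$, any SLCS formula $\phi$ and any $x\in X$: $x\in\mathtt{Sat}(\mathcal{M},\phi)$ if and only if $\mathcal{M},x\models\phi$.
   Context: For $R\subseteq X\times X$, $\mathcal{C}_R(A)=A\cup\{x\mid\exists a\in A.(a,x)\in R\}$; a finite quasi-discrete closure model is $((X,\mathcal{C}_R),\mathcal{V})$ with $X$ finite and $\mathcal{V}:AP\to 2^X$. Paths are continuous maps $p:(\mathbb{N},\mathcal{C}_\succ)\to(X,\mathcal{C}_R)$, where $\succ=\{(n,n+1)\}$ and continuity means $p(\mathcal{C}_\succ(S))\subseteq\mathcal{C}_R(p(S))$ for all $S\subseteq\mathbb{N}$. SLCS formulas: $\Phi::=a\mid\top\mid\lnot\Phi\mid\Phi\land\Phi\mid\mathcal{N}\Phi\mid\Phi\,\mathcal{S}\,\Phi\mid\Phi\rightsquigarrow\Phi$. Semantics: $x\models a$ iff $x\in\mathcal{V}(a)$; boolean connectives classically; $x\models\mathcal{N}\phi$ iff $x\in\mathcal{C}_R(\{y\mid y\models\phi\})$; $x\models\phi_1\,\mathcal{S}\,\phi_2$ iff $x\models\phi_1$ and for every path $p$ with $p(0)=x$ and every $l\in\mathbb{N}$, if $p(l)\models\lnot\phi_1$ then some $k$ with $0<k\le l$ has $p(k)\models\phi_2$; $x\models\phi_1\rightsquigarrow\phi_2$ iff $x\models\phi_2$ and there exist $y$, a path $p$ and $l$ with $p(0)=y$, $p(l)=x$, $y\models\phi_1$ and $p(i)\models\phi_2$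 for all $0<i<l$. Let $\mathit{pre}(x)=\{y\mid(y,x)\in R\}$, $\mathit{post}(x)=\{y\mid(x,y)\in R\}$. The procedure $\mathtt{Sat}(\mathcal{M},\phi)$ is defined recursively: $\top\mapsto X$; $a\mapsto\mathcal{V}(a)$; $\lnot\phi_1\mapsto X\setminus\mathtt{Sat}(\mathcal{M},\phi_1)$; $\phi_1\land\phi_2\mapsto\mathtt{Sat}(\mathcal{M},\phi_1)\cap\mathtt{Sat}(\mathcal{M},\phi_2)$; $\mathcal{N}\phi_1\mapsto\mathcal{C}_R(\mathtt{Sat}(\mathcal{M},\phi_1))$. For $\phi_1\,\mathcal{S}\,\phi_2$: $V:=\mathtt{Sat}(\mathcal{M},\phi_1)$, $Q:=\mathtt{Sat}(\mathcal{M},\phi_2)$, $T:=\mathcal{C}_R(V\cup Q)\setminus(V\cup Q)$; while $T\neq\emptyset$: $T':=\emptyset$, for each $x\in T$ let $N:=\mathit{pre}(x)\cap V$, set $V:=V\setminus N$, $T':=T'\cup(N\setminus Q)$; then $T:=T'$; return $V$. For $\phi_1\rightsquigarrow\phi_2$: $V:=\mathtt{Sat}(\mathcal{M},\phi_1)$, $Q:=\mathtt{Sat}(\mathcal{M},\phi_2)$, $T:=\mathcal{C}_R(V)\cap Q$, $S:=T$, $Q:=Q\setminus T$; while $T\neq\emptyset$: $T':=\emptyset$, for each $x\in T$ set $T':=T'\cup(Q\cap\mathit{post}(x))$; then $Q:=Q\setminus T'$, $S:=S\cup T'$, $T:=T'$; return $S$. -}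

module Defs where

open import Data.Empty using (⊥-elim)
open import Data.Fin.Base using (Fin)
open import Data.Fin.Properties using (any?)
import Data.Fin.Subset as Sub
open Sub using (Subset; inside; outside; Nonempty; _∩_; _∪_; _─_; ∁; ∣_∣)
open import Data.Fin.Subset.Properties using (_∈?_; nonempty?; drop-∷-⊆; ∣⊥∣≡0; ∣p─q∣≤∣p∣; ∣⁅x⁆∣≡1; p⊆q⇒∣p∣≤∣q∣; x∈⁅y⁆⇒x≡y; p∩q⊆p; p∩q⊆q; x∈p∪q⁻; ∉⊥)
open import Data.List.Base using (List; []; _∷_; allFin; filter; foldl; map)
open import Data.Nat.Base using (ℕ; suc; _+_; _≤_; _<_; s≤s; z≤n)
open import Data.Nat.Induction using (<-wellFounded)
open import Data.Nat.Properties using (+-assoc; +-identityʳ; +-monoˡ-≤; +-monoʳ-≤; +-monoʳ-<; +-suc; m≤n⇒m≤1+n; module ≤-Reasoning)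
open import Data.Product.Base using (_×_; _,_; ∃; ∃-syntax; Σ-syntax)
open import Data.Sum.Base using (_⊎_; [_,_]′)
open import Data.Unit.Polymorphic.Base using (⊤)
open import Data.Vec.Base using ([]; _∷_; here; tabulate)
open import Function.Base using (_∘_)
open import Function.Bundles using (_↔_; Inverse)
open import Induction.WellFounded using (Acc; acc)
open import Level using (Level; 0ℓ; Lift; _⊔_) renaming (suc to lsuc)
open import Relation.Binary.Core using (Rel)
import Relation.Binary.Definitions as Binary
open import Relation.Binary.PropositionalEquality using (_≡_; refl; sym; trans; cong; subst)
open import Relation.Nullary.Decidable using (Dec; yes; no; does; map′; _×-dec_; _⊎-dec_)
open import Relation.Nullary.Negation using (¬_)
open import Relation.Unary using (Pred; Decidable; _⊆_)

private
  variable
    ℓ r : Level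
    n : ℕ

𝒞 : {X : Set} → Rel X r → Pred X ℓ → Pred X (ℓ ⊔ r)
𝒞 R A x = A x ⊎ ∃[ a ] (A a × R a x)

image : {Y X : Set} → (Y → X) → Pred Y 0ℓ → Pred X 0ℓ
image f S x = ∃[ y ] (S y × f y ≡ x)

Continuous : {Y X : Set} → Rel Y 0ℓ → Rel X 0ℓ → (Y → X) → Set₁
Continuous R′ R f = (S : Pred _ 0ℓ) → image f (𝒞 R′ S) ⊆ 𝒞 R (image f S)

_≻_ : Rel ℕ 0ℓ
m ≻ n = n ≡ suc m

record Path {X : Set} (R : Rel X 0ℓ) : Set₁ where
  field
    _at_       : ℕ → X
    continuous : Continuous _≻_ R _at_

open Path public

-- Decidability of R and 𝒱 is what lets Sat be a computable procedure.  The
-- enumeration also fixes the (arbitrary) order in which its for-loops visit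
-- points.
record FiniteModel (AP : Set) : Set₁ where
  field
    X     : Set
    size  : ℕ
    index : X ↔ Fin size
    R     : Rel X 0ℓ
    R?    : Binary.Decidable R
    𝒱     : AP → Pred X 0ℓ
    𝒱?    : (a : AP) → Decidable (𝒱 a)

infixr 7 _∧′_
infix  6 _𝒮_ _⇝_
infix  8 ¬′_ 𝒩_

data Formula (AP : Set) : Set where
  atom : AP → Formula AP
  ⊤′   : Formula AP
  ¬′_  : Formula AP → Formula AP
  _∧′_ : Formula AP → Formula AP → Formula AP
  𝒩_   : Formula AP → Formula AP
  _𝒮_  : Formula AP → Formula AP → Formula AP
  _⇝_  : Formula AP → Formula AP → Formula AP

infix 3 _,_⊨_

_,_⊨_ : {AP : Set} (M : FiniteModel AP) → FiniteModel.X M → Formula AP → Set₁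
M , x ⊨ atom a   = Lift (lsuc 0ℓ) (FiniteModel.𝒱 M a x)
M , x ⊨ ⊤′       = ⊤
M , x ⊨ ¬′ φ     = ¬ (M , x ⊨ φ)
M , x ⊨ φ₁ ∧′ φ₂ = (M , x ⊨ φ₁) × (M , x ⊨ φ₂)
M , x ⊨ 𝒩 φ      = 𝒞 (FiniteModel.R M) (λ y → M , y ⊨ φ) x
M , x ⊨ φ₁ 𝒮 φ₂  =
  (M , x ⊨ φ₁) ×
  ((p : Path (FiniteModel.R M)) → p at 0 ≡ x → (l : ℕ) → ¬ (M , p at l ⊨ φ₁) →
     ∃[ k ] (0 < k × k ≤ l × (M , p at k ⊨ φ₂)))
M , x ⊨ φ₁ ⇝ φ₂  =
  (M , x ⊨ φ₂) ×
  (∃[ y ] Σ[ p ∈ Path (FiniteModel.R M) ] ∃[ l ]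
     (p at 0 ≡ y × p at l ≡ x × (M , y ⊨ φ₁) ×
      ((i : ℕ) → 0 < i → i < l → M , p at i ⊨ φ₂)))

∣p─q∣+∣q∣≡∣p∣ : (p q : Subset n) → q Sub.⊆ p → ∣ p ─ q ∣ + ∣ q ∣ ≡ ∣ p ∣
∣p─q∣+∣q∣≡∣p∣ []            []            q⊆p = refl
∣p─q∣+∣q∣≡∣p∣ (inside  ∷ p) (inside  ∷ q) q⊆p =
  trans (+-suc _ _) (cong suc (∣p─q∣+∣q∣≡∣p∣ p q (drop-∷-⊆ q⊆p)))
∣p─q∣+∣q∣≡∣p∣ (inside  ∷ p) (outside ∷ q) q⊆p = cong suc (∣p─q∣+∣q∣≡∣p∣ p q (drop-∷-⊆ q⊆p))
∣p─q∣+∣q∣≡∣p∣ (outside ∷ p) (outside ∷ q) q⊆p = ∣p─q∣+∣q∣≡∣p∣ p q (drop-∷-⊆ q⊆p)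
∣p─q∣+∣q∣≡∣p∣ (outside ∷ p) (inside  ∷ q) q⊆p with () ← q⊆p here

∣p∪q∣≤∣q∣+∣p∣ : (p q : Subset n) → ∣ p ∪ q ∣ ≤ ∣ q ∣ + ∣ p ∣
∣p∪q∣≤∣q∣+∣p∣ []            []            = z≤n
∣p∪q∣≤∣q∣+∣p∣ (outside ∷ p) (outside ∷ q) = ∣p∪q∣≤∣q∣+∣p∣ p q
∣p∪q∣≤∣q∣+∣p∣ (outside ∷ p) (inside  ∷ q) = s≤s (∣p∪q∣≤∣q∣+∣p∣ p q)
∣p∪q∣≤∣q∣+∣p∣ (inside  ∷ p) (outside ∷ q)
  rewrite +-suc ∣ q ∣ ∣ p ∣ = s≤s (∣p∪q∣≤∣q∣+∣p∣ p q)
∣p∪q∣≤∣q∣+∣p∣ (inside  ∷ p) (inside  ∷ q)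
  rewrite +-suc ∣ q ∣ ∣ p ∣ = s≤s (m≤n⇒m≤1+n (∣p∪q∣≤∣q∣+∣p∣ p q))

0<∣p∣ : {p : Subset n} → Nonempty p → 0 < ∣ p ∣
0<∣p∣ {p = p} (i , i∈p) = begin
  1            ≡⟨ ∣⁅x⁆∣≡1 i ⟨
  ∣ Sub.⁅ i ⁆ ∣ ≤⟨ p⊆q⇒∣p∣≤∣q∣ (λ j∈ → subst (Sub._∈ p) (sym (x∈⁅y⁆⇒x≡y i j∈)) i∈p) ⟩
  ∣ p ∣        ∎
  where open ≤-Reasoning

module Algorithm {AP : Set} (M : FiniteModel AP) where
  open FiniteModel M
  open Inverse index using (to; from; strictlyInverseʳ)

  PointSet : Set
  PointSet = Subset size

  ∅ : PointSet
  ∅ = Sub.⊥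

  infix 4 _∈_
  _∈_ : X → PointSet → Set
  x ∈ A = to x Sub.∈ A

  setOf : {P : Pred X ℓ} → Decidable P → PointSet
  setOf P? = tabulate (λ i → does (P? (from i)))

  ∃? : {P : Pred X ℓ} → Decidable P → Dec (∃ P)
  ∃? {P = P} P? = map′
    (λ (i , p) → from i , p)
    (λ (x , p) → to x , subst P (sym (strictlyInverseʳ x)) p)
    (any? (λ i → P? (from i)))

  𝒞? : {A : Pred X ℓ} → Decidable A → Decidable (𝒞 R A)
  𝒞? A? x = A? x ⊎-dec ∃? (λ a → A? a ×-dec R? a x)

  closure : PointSet → PointSet
  closure A = setOf (𝒞? (λ x → to x ∈? A))

  pre post : X → PointSet
  pre  x = setOf (λ y → R? y x)
  post x = setOf (λ y → R? x y)

  elements : PointSet → List X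
  elements A = filter (λ x → to x ∈? A) (map from (allFin size))

  forEach : {State : Set} → PointSet → (State → X → State) → State → State
  forEach T body s = foldl body s (elements T)

  -- The loops recurse on ∣ V ∣ + ∣ T ∣ (resp. ∣ Q ∣ + ∣ T ∣), which strictly
  -- decreases at each iteration because T is non-empty.

  surroundBody : PointSet → PointSet × PointSet → X → PointSet × PointSet
  surroundBody Q (V , T′) x = V ─ N , T′ ∪ (N ─ Q)
    where N = pre x ∩ V

  surroundStep : PointSet → PointSet → PointSet → PointSet × PointSet
  surroundStep Q V T = forEach T (surroundBody Q) (V , ∅)

  weight : PointSet × PointSet → ℕ
  weight (A , B) = ∣ A ∣ + ∣ B ∣

  surroundBody-weight : ∀ Q s x → weight (surroundBody Q s x) ≤ weight s
  surroundBody-weight Q (V , T′) x = begin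
    ∣ V ─ N ∣ + ∣ T′ ∪ (N ─ Q) ∣      ≤⟨ +-monoʳ-≤ (∣ V ─ N ∣) (∣p∪q∣≤∣q∣+∣p∣ T′ (N ─ Q)) ⟩
    ∣ V ─ N ∣ + (∣ N ─ Q ∣ + ∣ T′ ∣)  ≤⟨ +-monoʳ-≤ (∣ V ─ N ∣) (+-monoˡ-≤ (∣ T′ ∣) (∣p─q∣≤∣p∣ N Q)) ⟩
    ∣ V ─ N ∣ + (∣ N ∣ + ∣ T′ ∣)      ≡⟨ +-assoc (∣ V ─ N ∣) (∣ N ∣) (∣ T′ ∣) ⟨
    (∣ V ─ N ∣ + ∣ N ∣) + ∣ T′ ∣      ≡⟨ cong (_+ ∣ T′ ∣) (∣p─q∣+∣q∣≡∣p∣ V N (p∩q⊆q (pre x) V)) ⟩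
    ∣ V ∣ + ∣ T′ ∣                    ∎
    where
    open ≤-Reasoning
    N = pre x ∩ V

  surroundStep-weight : ∀ Q V T → Nonempty T → weight (surroundStep Q V T) < weight (V , T)
  surroundStep-weight Q V T ne = begin-strict
    weight (surroundStep Q V T) ≤⟨ go (elements T) (V , ∅) ⟩
    ∣ V ∣ + ∣ ∅ ∣               ≡⟨ cong (∣ V ∣ +_) (∣⊥∣≡0 size) ⟩
    ∣ V ∣ + 0                   <⟨ +-monoʳ-< ∣ V ∣ (0<∣p∣ ne) ⟩
    ∣ V ∣ + ∣ T ∣               ∎
    where
    open ≤-Reasoning
    go : ∀ xs s → weight (foldl (surroundBody Q) s xs) ≤ weight s
    go []       s = begin weight s ∎
    go (x ∷ xs) s = begin
      weight (foldl (surroundBody Q) (surroundBody Q s x) xs) ≤⟨ go xs (surroundBody Q s x) ⟩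
      weight (surroundBody Q s x)                             ≤⟨ surroundBody-weight Q s x ⟩
      weight s                                                ∎

  surroundLoop : (Q V T : PointSet) → Acc _<_ (weight (V , T)) → PointSet
  surroundLoop Q V T (acc rec) with nonempty? T
  ... | no  _  = V
  ... | yes ne =
    let (V′ , T′) = surroundStep Q V T
    in  surroundLoop Q V′ T′ (rec (surroundStep-weight Q V T ne))

  checkSurround : (V Q : PointSet) → PointSet
  checkSurround V Q = surroundLoop Q V T (<-wellFounded _)
    where T = closure (V ∪ Q) ─ (V ∪ Q)

  reachBody : PointSet → PointSet → X → PointSet
  reachBody Q T′ x = T′ ∪ (Q ∩ post x)

  reachStep : PointSet → PointSet → PointSet
  reachStep Q T = forEach T (reachBody Q) ∅

  reachStep-⊆ : ∀ Q T → reachStep Q T Sub.⊆ Q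
  reachStep-⊆ Q T = go (elements T) ∅ (⊥-elim ∘ ∉⊥)
    where
    go : ∀ xs T′ → T′ Sub.⊆ Q → foldl (reachBody Q) T′ xs Sub.⊆ Q
    go []       T′ T′⊆Q = T′⊆Q
    go (x ∷ xs) T′ T′⊆Q =
      go xs (reachBody Q T′ x) ([ T′⊆Q , p∩q⊆p Q (post x) ]′ ∘ x∈p∪q⁻ T′ (Q ∩ post x))

  reachStep-weight : ∀ Q T → Nonempty T →
                     weight (Q ─ reachStep Q T , reachStep Q T) < weight (Q , T)
  reachStep-weight Q T ne = begin-strict
    ∣ Q ─ reachStep Q T ∣ + ∣ reachStep Q T ∣ ≡⟨ ∣p─q∣+∣q∣≡∣p∣ Q (reachStep Q T) (reachStep-⊆ Q T) ⟩
    ∣ Q ∣                                     ≡⟨ +-identityʳ ∣ Q ∣ ⟨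
    ∣ Q ∣ + 0                                 <⟨ +-monoʳ-< ∣ Q ∣ (0<∣p∣ ne) ⟩
    ∣ Q ∣ + ∣ T ∣                             ∎
    where open ≤-Reasoning

  reachLoop : (Q S T : PointSet) → Acc _<_ (weight (Q , T)) → PointSet
  reachLoop Q S T (acc rec) with nonempty? T
  ... | no  _  = S
  ... | yes ne =
    let T′ = reachStep Q T
    in  reachLoop (Q ─ T′) (S ∪ T′) T′ (rec (reachStep-weight Q T ne))

  checkReach : (V Q : PointSet) → PointSet
  checkReach V Q = reachLoop (Q ─ T) T T (<-wellFounded _)
    where T = closure V ∩ Q

  Sat : Formula AP → PointSet
  Sat (atom a)   = setOf (𝒱? a)
  Sat ⊤′         = Sub.⊤
  Sat (¬′ φ)     = ∁ (Sat φ)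
  Sat (φ₁ ∧′ φ₂) = Sat φ₁ ∩ Sat φ₂
  Sat (𝒩 φ)      = closure (Sat φ)
  Sat (φ₁ 𝒮 φ₂)  = checkSurround (Sat φ₁) (Sat φ₂)
  Sat (φ₁ ⇝ φ₂)  = checkReach (Sat φ₁) (Sat φ₂)

{-# OPTIONS --safe #-}
-- A continuous map out of (ℕ, 𝒞_≻) is exactly a sequence whose every step stays
-- put or follows R, so finite R-chains and paths carry the same information.
--
-- Surround: only points with a chain that leaves φ₁ while avoiding φ₂ after its
-- start are ever removed from V, and at every iteration all R-successors
-- outside Q of a point of V lie in V or T.  When T is empty, V can therefore be
-- left along a path only through Q.
--
-- Reach: every collected point ends a chain from φ₁ running through φ₂, and at
-- every iteration a φ₂-successor of a point of S lies in S unless that point is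
-- in T.  When T is empty, S is closed under φ₂-successors.
module Submission where

open import Defs
import Data.Fin.Subset as Sub
open Sub using (Subset; inside; Empty; _∩_; _∪_; _─_)
open import Data.Fin.Subset.Properties using (_∈?_; nonempty?; ∉⊥; ∈⊤; x∈∁p⇒x∉p; x∉p⇒x∈∁p; x∈p∩q⁺; x∈p∩q⁻; p∩q⊆p; p∩q⊆q; x∈p∪q⁺; x∈p∪q⁻; p─q⊆p; x∈p∧x∉q⇒x∈p─q)
open import Data.List.Base using ([]; _∷_; allFin; foldl; map)
open import Data.List.Membership.Propositional using () renaming (_∈_ to _∈ₗ_)
open import Data.List.Membership.Propositional.Properties using (∈-filter⁺; ∈-filter⁻; ∈-map⁺; ∈-allFin)
open import Data.List.Relation.Unary.Any using (here; there)
open import Data.Nat.Base using (ℕ; zero; suc; _≤_; _<_; z≤n; s≤s; s≤s⁻¹)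
open import Data.Nat.Properties using (≤-refl; m≤n⇒m≤1+n; <⇒≤; m≤n⇒m<n∨m≡n)
open import Data.Product.Base using (_×_; _,_; proj₂; ∃-syntax; Σ-syntax)
open import Data.Product.Function.NonDependent.Propositional using (_×-⇔_)
open import Data.Sum.Base using (_⊎_; inj₁; inj₂; [_,_]′; map₁; map₂) renaming (map to map⊎)
open import Data.Vec.Base using (_∷_; here; there)
open import Data.Vec.Properties using ([]=⇒lookup; lookup⇒[]=; lookup∘tabulate)
open import Function.Base using (_∘_; id)
open import Function.Bundles using (_⇔_; mk⇔; Equivalence; Inverse)
import Function.Properties.Equivalence as ⇔
open import Function.Related.TypeIsomorphisms using (¬-cong-⇔)
open import Induction.WellFounded using (Acc; acc)
open import Level using (Level; 0ℓ; lift; lower)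
open import Relation.Binary.Construct.Closure.ReflexiveTransitive using (Star; ε; _◅_; _◅◅_)
open import Relation.Binary.Core using (Rel)
open import Relation.Binary.PropositionalEquality using (_≡_; refl; sym; trans; subst)
open import Relation.Nullary.Decidable using (yes; no; does; dec-true)
open import Relation.Nullary.Negation using (¬_; contradiction)
open import Relation.Unary using (Pred; Decidable)

private
  variable
    ℓ ℓ′ : Level
    n : ℕ

x∈p─q⇒x∉q : ∀ {x} (p q : Subset n) → x Sub.∈ p ─ q → x Sub.∉ q
x∈p─q⇒x∉q (_ ∷ p) (_       ∷ q) (there x∈p─q) (there x∈q) = x∈p─q⇒x∉q p q x∈p─q x∈q
x∈p─q⇒x∉q (_ ∷ p) (inside  ∷ q) ()            here

-- Paths as step sequences.

module _ {X : Set} {R : Rel X 0ℓ} where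

  steps⇒continuous : (f : ℕ → X) → (∀ n → f n ≡ f (suc n) ⊎ R (f n) (f (suc n))) →
                     Continuous _≻_ R f
  steps⇒continuous f step S (n , inj₁ Sn , eq) = inj₁ (n , Sn , eq)
  steps⇒continuous f step S (_ , inj₂ (m , Sm , refl) , refl) with step m
  ... | inj₁ eq = inj₁ (m , Sm , eq)
  ... | inj₂ r  = inj₂ (f m , (m , Sm , refl) , r)

  -- It suffices to test continuity on the singleton `n ≡_`, whose closure contains `suc n`.
  continuous⇒steps : (f : ℕ → X) → Continuous _≻_ R f →
                     ∀ n → f n ≡ f (suc n) ⊎ R (f n) (f (suc n))
  continuous⇒steps f cont n
    with cont (n ≡_) (suc n , inj₂ (n , refl , refl) , refl)
  ... | inj₁ (_ , refl , eq)           = inj₁ eq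
  ... | inj₂ (_ , (_ , refl , refl) , r) = inj₂ r

  constant : X → Path R
  constant x ._at_      = λ _ → x
  constant x .continuous = steps⇒continuous _ (λ _ → inj₁ refl)

  prepend : (x : X) (p : Path R) → R x (p at 0) → Path R
  prepend x p r = record { _at_ = f ; continuous = steps⇒continuous f step }
    where
    f : ℕ → X
    f zero    = x
    f (suc n) = p at n
    step : ∀ n → f n ≡ f (suc n) ⊎ R (f n) (f (suc n))
    step zero    = inj₂ r
    step (suc n) = continuous⇒steps (p at_) (continuous p) n

  -- Only the target of an edge is constrained, so the start of a chain is free. This matches the
  -- bounds `0 < k` and `0 < i` in the semantics.
  Into : Pred X ℓ → Rel X ℓ
  Into A y z = R y z × A z

  -- Once the chain ends, the path stays at `y` forever, which continuity allows.
  chain⇒path : {A : Pred X ℓ} {x y : X} → Star (Into A) x y →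
               Σ[ p ∈ Path R ] ∃[ l ] (p at 0 ≡ x × p at l ≡ y ×
                 (∀ i → 0 < i → i ≤ l → A (p at i)))
  chain⇒path {x = x} ε = constant x , 0 , refl , refl , λ { (suc _) _ () }
  chain⇒path {x = x} ((r , a) ◅ chain) with chain⇒path chain
  ... | p , l , refl , pl≡y , inA =
    prepend x p r , suc l , refl , pl≡y , λ where
      (suc zero)    _ _   → a
      (suc (suc i)) _ i≤l → inA (suc i) (s≤s z≤n) (s≤s⁻¹ i≤l)

  -- Induction on `l`; a step that stays put remains in `W`. Surround takes `Q` for `B`, reach takes
  -- the complement of `Q₀`.
  leaves-only-through : {W : Pred X ℓ} {B : Pred X ℓ′} →
    (∀ {y z} → W y → R y z → B z ⊎ W z) →
    (p : Path R) → W (p at 0) →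
    ∀ l → (∃[ k ] (0 < k × k ≤ l × B (p at k))) ⊎ W (p at l)
  leaves-only-through         step p w₀ zero = inj₂ w₀
  leaves-only-through {W = W} step p w₀ (suc l)
    with leaves-only-through step p w₀ l
  ... | inj₁ (k , 0<k , k≤l , b) = inj₁ (k , 0<k , m≤n⇒m≤1+n k≤l , b)
  ... | inj₂ w with continuous⇒steps (p at_) (continuous p) l
  ...   | inj₁ eq = inj₂ (subst W eq w)
  ...   | inj₂ r  = map₁ (λ b → suc l , s≤s z≤n , ≤-refl , b) (step w r)

-- Membership in computed sets, and invariant rules for the loops.

module _ {AP : Set} (M : FiniteModel AP) where
  open FiniteModel M
  open Algorithm M
  open Inverse index using (to; from; strictlyInverseʳ)

  infix 4 _∉_
  _∉_ : X → PointSet → Set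
  x ∉ A = ¬ (x ∈ A)

  ∈-setOf : {P : Pred X ℓ} (P? : Decidable P) {x : X} → x ∈ setOf P? ⇔ P x
  ∈-setOf {P = P} P? {x} = mk⇔ ⁻ ⁺
    where
    lookup-setOf = lookup∘tabulate (does ∘ P? ∘ from) (to x)

    ⁻ : x ∈ setOf P? → P x
    ⁻ x∈ with P? (from (to x)) | trans (sym lookup-setOf) ([]=⇒lookup x∈)
    ... | yes q | _ = subst P (strictlyInverseʳ x) q
    ... | no  _ | ()

    ⁺ : P x → x ∈ setOf P?
    ⁺ q = lookup⇒[]= (to x) _
      (trans lookup-setOf (dec-true (P? _) (subst P (sym (strictlyInverseʳ x)) q)))

  ∈-pre : ∀ {x y} → y ∈ pre x ⇔ R y x
  ∈-pre {x} = ∈-setOf (λ y → R? y x)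

  ∈-post : ∀ {x y} → y ∈ post x ⇔ R x y
  ∈-post {x} = ∈-setOf (λ y → R? x y)

  ∈-closure : ∀ A {x} → x ∈ closure A ⇔ 𝒞 R (_∈ A) x
  ∈-closure A = ∈-setOf (𝒞? (λ x → to x ∈? A))

  ∈-elements⁺ : ∀ {A x} → x ∈ A → x ∈ₗ elements A
  ∈-elements⁺ {A} {x} =
    ∈-filter⁺ (λ y → to y ∈? A) {xs = map from (allFin size)}
      (subst (_∈ₗ _) (strictlyInverseʳ x) (∈-map⁺ from (∈-allFin (to x))))

  ∈-elements⁻ : ∀ {A x} → x ∈ₗ elements A → x ∈ A
  ∈-elements⁻ {A} = proj₂ ∘ ∈-filter⁻ (λ y → to y ∈? A) {xs = map from (allFin size)}

  -- Recursion follows the same `Acc` argument as the loop. The witness `T′` is the frontier on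
  -- exit.
  surroundLoop-invariant :
    (Q : PointSet) (I : PointSet → PointSet → Set) →
    (∀ {V T} → I V T → let (V′ , T′) = surroundStep Q V T in I V′ T′) →
    ∀ {V T} → I V T → (rec : Acc _<_ (weight (V , T))) →
    ∃[ T′ ] (Empty T′ × I (surroundLoop Q V T rec) T′)
  surroundLoop-invariant Q I step {T = T} i (acc rec) with nonempty? T
  ... | no  empty = T , empty , i
  ... | yes ne    = surroundLoop-invariant Q I step (step i) (rec _)

  reachLoop-invariant :
    (I : PointSet → PointSet → PointSet → Set) →
    (∀ {Q S T} → I Q S T → let T′ = reachStep Q T in I (Q ─ T′) (S ∪ T′) T′) →
    ∀ {Q S T} → I Q S T → (rec : Acc _<_ (weight (Q , T))) →
    ∃[ Q′ ] ∃[ T′ ] (Empty T′ × I Q′ (reachLoop Q S T rec) T′)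
  reachLoop-invariant I step {Q} {T = T} i (acc rec) with nonempty? T
  ... | no  empty = Q , T , empty , i
  ... | yes ne    = reachLoop-invariant I step (step i) (rec _)

  -- Correctness of the surround loop.

  module Surround (V₀ Q : PointSet) where

    -- A finite counterexample to being surrounded. The point `x` itself may lie in `Q`.
    Escapes : Pred X 0ℓ
    Escapes x = ∃[ u ] (u ∉ V₀ × Star (Into {R = R} (_∉ Q)) x u)

    -- During the for-loop the frontier F is the unvisited part of T together
    -- with T′.
    record Invariant (F : Pred X 0ℓ) (V : PointSet) : Set where
      field
        shrinks  : ∀ {y} → y ∈ V → y ∈ V₀
        removed  : ∀ {y} → y ∈ V₀ → y ∈ V ⊎ Escapes y
        frontier : ∀ {z} → F z → z ∉ Q × Escapes z
        guarded  : ∀ {y z} → y ∈ V → R y z → z ∉ Q → z ∈ V ⊎ F z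
    open Invariant

    weaken : ∀ {F G V} → (∀ {z} → F z → G z) → (∀ {z} → G z → F z) →
             Invariant F V → Invariant G V
    weaken F⇒G G⇒F inv .shrinks            = inv .shrinks
    weaken F⇒G G⇒F inv .removed            = inv .removed
    weaken F⇒G G⇒F inv .frontier           = inv .frontier ∘ G⇒F
    weaken F⇒G G⇒F inv .guarded y∈V r z∉Q = map₂ F⇒G (inv .guarded y∈V r z∉Q)

    -- Initial frontier points are already outside `V₀`, so they escape along the empty chain.
    initial : let T = closure (V₀ ∪ Q) ─ (V₀ ∪ Q) in Invariant (_∈ T) V₀
    initial .shrinks = id
    initial .removed = inj₁
    initial .frontier {z} z∈T =
      (λ z∈Q → z∉V∪Q (x∈p∪q⁺ (inj₂ z∈Q))) ,
      z , (λ z∈V → z∉V∪Q (x∈p∪q⁺ {p = V₀} {q = Q} (inj₁ z∈V))) , ε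
      where
      z∉V∪Q : z ∉ V₀ ∪ Q
      z∉V∪Q = x∈p─q⇒x∉q (closure (V₀ ∪ Q)) (V₀ ∪ Q) z∈T
    initial .guarded {y} {z} y∈V r z∉Q with to z ∈? V₀
    ... | yes z∈V = inj₁ z∈V
    ... | no  z∉V = inj₂ (x∈p∧x∉q⇒x∈p─q
      (Equivalence.from (∈-closure (V₀ ∪ Q)) (inj₂ (y , x∈p∪q⁺ (inj₁ y∈V) , r)))
      ([ z∉V , z∉Q ]′ ∘ x∈p∪q⁻ V₀ Q))

    -- Prepending the edge into `x` to an escape of `x` makes all of `N` escape. Afterwards `V`
    -- contains no predecessor of `x`, so `x` may leave the frontier.
    body : ∀ x xs {V T′} → Invariant (λ z → z ∈ₗ x ∷ xs ⊎ z ∈ T′) V →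
           let (V″ , T″) = surroundBody Q (V , T′) x in
           Invariant (λ z → z ∈ₗ xs ⊎ z ∈ T″) V″
    body x xs {V} {T′} inv = λ where
        .shrinks y∈ → inv .shrinks (p─q⊆p V N y∈)
        .removed y∈V₀ → [ kept-or-removed , inj₂ ]′ (inv .removed y∈V₀)
        .frontier → [ inv .frontier ∘ inj₁ ∘ there ,
                      [ inv .frontier ∘ inj₂ , new-frontier ]′ ∘ x∈p∪q⁻ T′ (N ─ Q) ]′
        .guarded y∈ r z∉Q →
          stays-guarded y∈ r z∉Q (inv .guarded (p─q⊆p V N y∈) r z∉Q)
      where
      N = pre x ∩ V

      pre-escapes : ∀ {y} → y ∈ N → Escapes y
      pre-escapes y∈N with inv .frontier (inj₁ (here refl))
      -- The `frontier` field records `x∉Q` so that the edge into `x` is a legal `Into` step.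
      ... | x∉Q , u , u∉V₀ , chain =
        u , u∉V₀ , (Equivalence.to ∈-pre (p∩q⊆p (pre x) V y∈N) , x∉Q) ◅ chain

      kept-or-removed : ∀ {y} → y ∈ V → y ∈ V ─ N ⊎ Escapes y
      kept-or-removed {y} y∈V with to y ∈? N
      ... | yes y∈N = inj₂ (pre-escapes y∈N)
      ... | no  y∉N = inj₁ (x∈p∧x∉q⇒x∈p─q y∈V y∉N)

      new-frontier : ∀ {z} → z ∈ N ─ Q → z ∉ Q × Escapes z
      new-frontier z∈ = x∈p─q⇒x∉q N Q z∈ , pre-escapes (p─q⊆p N Q z∈)

      stays-guarded : ∀ {y z} → y ∈ V ─ N → R y z → z ∉ Q →
                      z ∈ V ⊎ (z ∈ₗ x ∷ xs ⊎ z ∈ T′) →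
                      z ∈ V ─ N ⊎ (z ∈ₗ xs ⊎ z ∈ T′ ∪ (N ─ Q))
      -- The successor `z` may itself be deleted now; lying outside `Q`, it then joins the frontier.
      stays-guarded {z = z} y∈ r z∉Q (inj₁ z∈V) with to z ∈? N
      ... | yes z∈N = inj₂ (inj₂ (x∈p∪q⁺ (inj₂ (x∈p∧x∉q⇒x∈p─q z∈N z∉Q))))
      ... | no  z∉N = inj₁ (x∈p∧x∉q⇒x∈p─q z∈V z∉N)
      stays-guarded y∈ r z∉Q (inj₂ (inj₁ (here refl))) =
        contradiction (x∈p∩q⁺ (Equivalence.from ∈-pre r , p─q⊆p V N y∈))
                      (x∈p─q⇒x∉q V N y∈)
      stays-guarded y∈ r z∉Q (inj₂ (inj₁ (there z∈xs))) = inj₂ (inj₁ z∈xs)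
      stays-guarded y∈ r z∉Q (inj₂ (inj₂ z∈T′)) =
        inj₂ (inj₂ (x∈p∪q⁺ (inj₁ z∈T′)))

    forEach-body : ∀ xs {V T′} → Invariant (λ z → z ∈ₗ xs ⊎ z ∈ T′) V →
                   let (V″ , T″) = foldl (surroundBody Q) (V , T′) xs in
                   Invariant (_∈ T″) V″
    forEach-body []       = weaken [ (λ ()) , id ]′ inj₂
    forEach-body (x ∷ xs) = forEach-body xs ∘ body x xs

    step : ∀ {V T} → Invariant (_∈ T) V →
           let (V′ , T′) = surroundStep Q V T in Invariant (_∈ T′) V′
    step {T = T} =
      forEach-body (elements T) ∘
      weaken (inj₁ ∘ ∈-elements⁺) [ ∈-elements⁻ , (λ z∈∅ → contradiction z∈∅ ∉⊥) ]′

    result : ∃[ T ] (Empty T × Invariant (_∈ T) (checkSurround V₀ Q))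
    result = surroundLoop-invariant Q (λ V T → Invariant (_∈ T) V) step initial _

    -- The semantics with point sets in place of subformulas, which separates the loop from the
    -- induction on formulas.
    Surrounded : Pred X _
    Surrounded x =
      x ∈ V₀ × ((p : Path R) → p at 0 ≡ x → ∀ l → p at l ∉ V₀ →
                ∃[ k ] (0 < k × k ≤ l × p at k ∈ Q))

    correct : ∀ {x} → x ∈ checkSurround V₀ Q ⇔ Surrounded x
    correct {x} with result
    ... | T , empty , inv = mk⇔ sound complete
      where
      W = checkSurround V₀ Q

      exits : ∀ {y z} → y ∈ W → R y z → z ∈ Q ⊎ z ∈ W
      exits {z = z} y∈W r with to z ∈? Q
      ... | yes z∈Q = inj₁ z∈Q
      ... | no  z∉Q = inj₂ ([ id , (λ z∈T → contradiction (to z , z∈T) empty) ]′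
                              (inv .guarded y∈W r z∉Q))

      sound : x ∈ W → Surrounded x
      sound x∈W = inv .shrinks x∈W , λ { p refl l pl∉V₀ →
        [ id , (λ pl∈W → contradiction (inv .shrinks pl∈W) pl∉V₀) ]′
          (leaves-only-through {W = _∈ W} {B = _∈ Q} exits p x∈W l) }

      complete : Surrounded x → x ∈ W
      complete (x∈V₀ , stopped) with inv .removed x∈V₀
      ... | inj₁ x∈W = x∈W
      -- The escape becomes a path ending outside `V₀` that never meets `Q` after its start.
      ... | inj₂ (u , u∉V₀ , chain) with chain⇒path chain
      ...   | p , l , p₀≡x , refl , avoids with stopped p p₀≡x l u∉V₀
      ...     | k , 0<k , k≤l , pk∈Q = contradiction pk∈Q (avoids k 0<k k≤l)

  -- Correctness of the reach loop.

  module Reach (V Q₀ : PointSet) where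

    T₀ : PointSet
    T₀ = closure V ∩ Q₀

    -- The conjunct `x ∈ Q₀` is separate because an empty chain says nothing about its endpoint.
    Reached : Pred X 0ℓ
    Reached x = x ∈ Q₀ × ∃[ v ] (v ∈ V × Star (Into {R = R} (_∈ Q₀)) v x)

    reached-step : ∀ {y z} → Reached y → R y z → z ∈ Q₀ → Reached z
    reached-step (_ , v , v∈V , chain) r z∈Q₀ =
      z∈Q₀ , v , v∈V , chain ◅◅ ((r , z∈Q₀) ◅ ε)

    -- The loop searches only the remaining `Q`; `covers` ensures that whatever it skips in `Q₀` is
    -- already collected. `starts` accounts for the first edge out of `V`.
    record Invariant (Q S T : PointSet) : Set where
      field
        starts  : ∀ {z} → z ∈ T₀ → z ∈ S
        reached : ∀ {z} → z ∈ S → Reached z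
        T⊆S     : ∀ {z} → z ∈ T → z ∈ S
        Q⊆Q₀    : ∀ {z} → z ∈ Q → z ∈ Q₀
        covers  : ∀ {z} → z ∈ Q₀ → z ∈ Q ⊎ z ∈ S
        closed  : ∀ {y z} → y ∈ S → R y z → z ∈ Q₀ → z ∈ S ⊎ y ∈ T
    open Invariant

    ∈-T₀⁺ : ∀ {x} → 𝒞 R (_∈ V) x → x ∈ Q₀ → x ∈ T₀
    ∈-T₀⁺ x∈𝒞 x∈Q₀ = x∈p∩q⁺ (Equivalence.from (∈-closure V) x∈𝒞 , x∈Q₀)

    initial : Invariant (Q₀ ─ T₀) T₀ T₀
    initial .starts = id
    initial .reached {z} z∈T₀ with x∈p∩q⁻ (closure V) Q₀ z∈T₀
    ... | z∈cl , z∈Q₀ with Equivalence.to (∈-closure V) z∈cl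
    ...   | inj₁ z∈V           = z∈Q₀ , z , z∈V , ε
    ...   | inj₂ (v , v∈V , r) = z∈Q₀ , v , v∈V , (r , z∈Q₀) ◅ ε
    initial .T⊆S    = id
    initial .Q⊆Q₀   = p─q⊆p Q₀ T₀
    initial .covers {z} z∈Q₀ with to z ∈? T₀
    ... | yes z∈T₀ = inj₂ z∈T₀
    ... | no  z∉T₀ = inj₁ (x∈p∧x∉q⇒x∈p─q z∈Q₀ z∉T₀)
    -- At the start `S` and `T` coincide, so every collected point is still unexplored.
    initial .closed y∈T₀ _ _ = inj₂ y∈T₀

    forEach-body⁻ : ∀ Q xs {T′ z} → z ∈ foldl (reachBody Q) T′ xs →
                    z ∈ T′ ⊎ ∃[ y ] (y ∈ₗ xs × R y z)
    forEach-body⁻ Q []       z∈ = inj₁ z∈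
    forEach-body⁻ Q (x ∷ xs) {T′} z∈ with forEach-body⁻ Q xs z∈
    ... | inj₂ (y , y∈xs , r) = inj₂ (y , there y∈xs , r)
    ... | inj₁ z∈T″ =
      map₂ (λ z∈ → x , here refl , Equivalence.to ∈-post (p∩q⊆q Q (post x) z∈))
           (x∈p∪q⁻ T′ (Q ∩ post x) z∈T″)

    forEach-body⁺ : ∀ Q xs {T′ z} → z ∈ T′ ⊎ (z ∈ Q × ∃[ y ] (y ∈ₗ xs × R y z)) →
                    z ∈ foldl (reachBody Q) T′ xs
    forEach-body⁺ Q []       (inj₁ z∈T′) = z∈T′
    forEach-body⁺ Q []       (inj₂ (_ , _ , () , _))
    forEach-body⁺ Q (x ∷ xs) (inj₁ z∈T′) =
      forEach-body⁺ Q xs (inj₁ (x∈p∪q⁺ (inj₁ z∈T′)))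
    forEach-body⁺ Q (x ∷ xs) (inj₂ (z∈Q , _ , here refl , r)) =
      forEach-body⁺ Q xs
        (inj₁ (x∈p∪q⁺ (inj₂ (x∈p∩q⁺ (z∈Q , Equivalence.from ∈-post r)))))
    forEach-body⁺ Q (x ∷ xs) (inj₂ (z∈Q , y , there y∈xs , r)) =
      forEach-body⁺ Q xs (inj₂ (z∈Q , y , y∈xs , r))

    -- New points form the new frontier, so `closed` needs an argument only for old `y`. If a
    -- successor of `y` is missing from `S`, then `y` is in `T` and the successor is in `Q`, so this
    -- pass collects it.
    step : ∀ {Q S T} → Invariant Q S T →
           let T′ = reachStep Q T in Invariant (Q ─ T′) (S ∪ T′) T′
    step {Q} {S} {T} inv = λ where
        .starts z∈T₀ → x∈p∪q⁺ (inj₁ (inv .starts z∈T₀))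
        .reached → [ inv .reached , new-reached ]′ ∘ x∈p∪q⁻ S T′
        .T⊆S z∈T′ → x∈p∪q⁺ (inj₂ z∈T′)
        .Q⊆Q₀ → inv .Q⊆Q₀ ∘ p─q⊆p Q T′
        .covers z∈Q₀ → [ still-covered , (λ z∈S → inj₂ (x∈p∪q⁺ (inj₁ z∈S))) ]′
                         (inv .covers z∈Q₀)
        .closed y∈S∪T′ r z∈Q₀ →
          [ (λ y∈S → inj₁ (successor y∈S r z∈Q₀)) , inj₂ ]′ (x∈p∪q⁻ S T′ y∈S∪T′)
      where
      T′ = reachStep Q T

      new-reached : ∀ {z} → z ∈ T′ → Reached z
      new-reached z∈T′ with forEach-body⁻ Q (elements T) z∈T′
      ... | inj₁ z∈∅ = contradiction z∈∅ ∉⊥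
      ... | inj₂ (y , y∈T , r) =
        reached-step (inv .reached (inv .T⊆S (∈-elements⁻ y∈T))) r
                     (inv .Q⊆Q₀ (reachStep-⊆ Q T z∈T′))

      still-covered : ∀ {z} → z ∈ Q → z ∈ Q ─ T′ ⊎ z ∈ S ∪ T′
      still-covered {z} z∈Q with to z ∈? T′
      ... | yes z∈T′ = inj₂ (x∈p∪q⁺ (inj₂ z∈T′))
      ... | no  z∉T′ = inj₁ (x∈p∧x∉q⇒x∈p─q z∈Q z∉T′)

      successor : ∀ {y z} → y ∈ S → R y z → z ∈ Q₀ → z ∈ S ∪ T′
      successor {y} y∈S r z∈Q₀ with inv .closed y∈S r z∈Q₀ | inv .covers z∈Q₀
      ... | inj₁ z∈S | _        = x∈p∪q⁺ (inj₁ z∈S)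
      ... | inj₂ _   | inj₂ z∈S = x∈p∪q⁺ (inj₁ z∈S)
      ... | inj₂ y∈T | inj₁ z∈Q = x∈p∪q⁺ (inj₂
        (forEach-body⁺ Q (elements T) (inj₂ (z∈Q , y , ∈-elements⁺ y∈T , r))))

    result : ∃[ Q ] ∃[ T ] (Empty T × Invariant Q (checkReach V Q₀) T)
    result = reachLoop-invariant Invariant step initial _

    ReachedByPath : Pred X _
    ReachedByPath x =
      x ∈ Q₀ × ∃[ y ] Σ[ p ∈ Path R ] ∃[ l ]
        (p at 0 ≡ y × p at l ≡ x × y ∈ V ×
         (∀ i → 0 < i → i < l → p at i ∈ Q₀))

    correct : ∀ {x} → x ∈ checkReach V Q₀ ⇔ ReachedByPath x
    correct {x} with result
    ... | Q , T , empty , inv = mk⇔ sound complete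
      where
      W = checkReach V Q₀

      sound : x ∈ W → ReachedByPath x
      sound x∈W with inv .reached x∈W
      ... | x∈Q₀ , v , v∈V , chain with chain⇒path chain
      ...   | p , l , p₀≡v , pl≡x , within =
        x∈Q₀ , v , p , l , p₀≡v , pl≡x , v∈V ,
        λ i 0<i i<l → within i 0<i (<⇒≤ i<l)

      -- A path may linger at its start, which need not lie in `Q₀` or `W`; hence the preserved set
      -- includes `V`.
      exits : ∀ {y z} → y ∈ V ⊎ y ∈ W → R y z → z ∉ Q₀ ⊎ (z ∈ V ⊎ z ∈ W)
      exits {y} {z} y∈ r with to z ∈? Q₀
      ... | no  z∉Q₀ = inj₁ z∉Q₀
      ... | yes z∈Q₀ = inj₂ (inj₂ ([ from-V , from-W ]′ y∈))
        where
        from-V : y ∈ V → z ∈ W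
        from-V y∈V = inv .starts (∈-T₀⁺ (inj₂ (y , y∈V , r)) z∈Q₀)
        from-W : y ∈ W → z ∈ W
        from-W y∈W = [ id , (λ y∈T → contradiction (to y , y∈T) empty) ]′
                       (inv .closed y∈W r z∈Q₀)

      complete : ReachedByPath x → x ∈ W
      complete (x∈Q₀ , _ , p , l , refl , refl , p₀∈V , within)
        with leaves-only-through {W = λ y → y ∈ V ⊎ y ∈ W} {B = _∉ Q₀}
               exits p (inj₁ p₀∈V) l
      ... | inj₂ (inj₁ x∈V) = inv .starts (∈-T₀⁺ (inj₁ x∈V) x∈Q₀)
      ... | inj₂ (inj₂ x∈W) = x∈W
      -- The hypothesis `within` stops before `l`; the endpoint is covered by `x∈Q₀`.
      ... | inj₁ (k , 0<k , k≤l , pk∉Q₀) with m≤n⇒m<n∨m≡n k≤l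
      ...   | inj₁ k<l  = contradiction (within k 0<k k<l) pk∉Q₀
      ...   | inj₂ refl = contradiction x∈Q₀ pk∉Q₀

-- Structural induction on formulas.

theorem6p3 : {AP : Set} (M : FiniteModel AP) (φ : Formula AP) (x : FiniteModel.X M) →
    let open Algorithm M in
    (x ∈ Sat φ) ⇔ (M , x ⊨ φ)
theorem6p3 M (atom a) x = ⇔.trans (∈-setOf M (FiniteModel.𝒱? M a)) (mk⇔ lift lower)
theorem6p3 M ⊤′ x = mk⇔ _ (λ _ → ∈⊤)
theorem6p3 M (¬′ φ) x =
  ⇔.trans (mk⇔ x∈∁p⇒x∉p x∉p⇒x∈∁p) (¬-cong-⇔ (theorem6p3 M φ x))
theorem6p3 M (φ₁ ∧′ φ₂) x =
  ⇔.trans (mk⇔ (x∈p∩q⁻ _ _) x∈p∩q⁺) (theorem6p3 M φ₁ x ×-⇔ theorem6p3 M φ₂ x)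
theorem6p3 M (𝒩 φ) x = ⇔.trans (∈-closure M (Algorithm.Sat M φ)) (mk⇔
  (map⊎ (to (theorem6p3 M φ _)) λ (a , a∈ , r) → a , to (theorem6p3 M φ a) a∈ , r)
  (map⊎ (from (theorem6p3 M φ _)) λ (a , a⊨ , r) → a , from (theorem6p3 M φ a) a⊨ , r))
  where open Equivalence
theorem6p3 M (φ₁ 𝒮 φ₂) x =
  ⇔.trans (Surround.correct M (Algorithm.Sat M φ₁) (Algorithm.Sat M φ₂)) (mk⇔
    (λ (x∈ , stopped) → to₁ x∈ , λ p p₀≡x l pl⊭ →
      let (k , 0<k , k≤l , pk∈) = stopped p p₀≡x l (pl⊭ ∘ to₁)
      in  k , 0<k , k≤l , to₂ pk∈)
    (λ (x⊨ , stopped) → from₁ x⊨ , λ p p₀≡x l pl∉ →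
      let (k , 0<k , k≤l , pk⊨) = stopped p p₀≡x l (pl∉ ∘ from₁)
      in  k , 0<k , k≤l , from₂ pk⊨))
  where
  -- The induction hypotheses are used at every point of a path, so the point stays implicit.
  open module E₁ {y} = Equivalence (theorem6p3 M φ₁ y) using () renaming (to to to₁; from to from₁)
  open module E₂ {y} = Equivalence (theorem6p3 M φ₂ y) using () renaming (to to to₂; from to from₂)
theorem6p3 M (φ₁ ⇝ φ₂) x =
  ⇔.trans (Reach.correct M (Algorithm.Sat M φ₁) (Algorithm.Sat M φ₂)) (mk⇔
    (λ (x∈ , y , p , l , p₀≡y , pl≡x , y∈ , within) →
      to₂ x∈ , y , p , l , p₀≡y , pl≡x , to₁ y∈ ,
      λ i 0<i i<l → to₂ (within i 0<i i<l))
    (λ (x⊨ , y , p , l , p₀≡y , pl≡x , y⊨ , within) →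
      from₂ x⊨ , y , p , l , p₀≡y , pl≡x , from₁ y⊨ ,
      λ i 0<i i<l → from₂ (within i 0<i i<l)))
  where
  open module E₁ {y} = Equivalence (theorem6p3 M φ₁ y) using () renaming (to to to₁; from to from₁)
  open module E₂ {y} = Equivalence (theorem6p3 M φ₂ y) using () renaming (to to to₂; from to from₂)
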